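{- Let $A$ be a set of atoms. For all terms $s,t$ (possibly containing variables) over the signature $\Sigma_{\mathrm{SCL}}(A)=\{\wedge,\vee,\neg,\mathsf T,\mathsf F\}\cup A$, $$\mathrm{CL}_2\vdash s=t\iff \mathrm{C\ell SCL}_2\vdash s=t.$$
   Context: $\vdash$ denotes derivability in equational logic (variables in axioms may be instantiated by arbitrary terms). Here $\wedge,\vee$ are binary symbols for the (noncommutative) short-circuit conjunction and disjunction, $\neg$ is unary, and $\mathsf T,\mathsf F$ and all atoms $a\in A$ are constants. $\mathrm{CL}_2$ is the equational theory with the axioms: (a) $\neg\neg x=x$; (b) $\neg(x\wedge y)=\neg x\vee\neg y$; (c) $(x\wedge y)\wedge z=x\wedge(y\wedge z)$; (d) $x\wedge(y\vee z)=(x\wedge y)\vee(x\wedge z)$; (e) $(x\vee y)\wedge z=(x\wedge z)\vee(\neg x\wedge y\wedge z)$ (bracketing immaterial by (c)); (f) $x\vee(x\wedge y)=x$; (g) $(x\wedge y)\vee(y\wedge x)=(y\wedge x)\vee(x\wedge y)$; together with $\mathsf T\wedge x=x$ and $\neg\mathsf T=\mathsf F$. The ternary conditional is written $x\lhd y\rhd z$ ("if $y$ then $x$ else $z$"). $\mathrm{CP}$ consists of: $x\lhd\mathsf T\rhd y=x$; $x\lhd\mathsf F\rhd y=y$; $\mathsf T\lhd x\rhd\mathsf F=x$; $x\lhd(y\lhd z\rhd u)\rhd v=(x\lhd y\rhd v)\lhd z\rhd(x\lhd u\rhd v)$. $\mathrm{CP}_{mem}$ is $\mathrm{CP}$ plus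 $x\lhd y\rhd(z\lhd u\rhd(v\lhd y\rhd w))=x\lhd y\rhd(z\lhd u\rhd w)$. $\mathrm{CP}_{cl}$ is $\mathrm{CP}_{mem}$ plus $(x\lhd y\rhd z)\lhd u\rhd(v\lhd y\rhd w)=(x\lhd u\rhd v)\lhd y\rhd(z\lhd u\rhd w)$. $\mathrm{C\ell SCL}_2$ (two-valued conditional short-circuit logic) is the set of consequences, restricted to the signature without the conditional, of $\mathrm{CP}_{cl}\cup\{\neg x=\mathsf F\lhd x\rhd\mathsf T,\ x\wedge y=y\lhd x\rhd\mathsf F\}$, where additionally $\mathsf F=\neg\mathsf T$ and $x\vee y=\neg(\neg x\wedge\neg y)$. That is, for terms $s,t$ over $\Sigma_{\mathrm{SCL}}(A)$, $\mathrm{C\ell SCL}_2\vdash s=t$ means that $s=t$ is derivable from all these equations in the combined signature. -}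

module Defs where

open import Data.Nat.Base using (ℕ)
open import Level using (Level; _⊔_)
open import Relation.Binary.Core using (Rel; _⇒_)

private
  variable
    a ℓ : Level
    A : Set a

-- Both term types take their variables from the countably infinite set ℕ;
-- atoms are constants, so they are kept apart from variables.

infixr 7 _∧_
infixr 6 _∨_
infix  8 ¬_

data SCLTerm (A : Set a) : Set a where
  var     : ℕ → SCLTerm A
  atom    : A → SCLTerm A
  𝖳 𝖥     : SCLTerm A
  ¬_      : SCLTerm A → SCLTerm A
  _∧_ _∨_ : SCLTerm A → SCLTerm A → SCLTerm A

-- The combined signature: SCLTerm extended with the conditional
-- x ◁ y ▷ z ("if y then x else z").

infix 5 _◁_▷_

data CTerm (A : Set a) : Set a where
  var     : ℕ → CTerm A
  atom    : A → CTerm A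
  𝖳 𝖥     : CTerm A
  ¬_      : CTerm A → CTerm A
  _∧_ _∨_ : CTerm A → CTerm A → CTerm A
  _◁_▷_   : CTerm A → CTerm A → CTerm A → CTerm A

embed : SCLTerm A → CTerm A
embed (var n)  = var n
embed (atom b) = atom b
embed 𝖳        = 𝖳
embed 𝖥        = 𝖥
embed (¬ s)    = ¬ embed s
embed (s ∧ t)  = embed s ∧ embed t
embed (s ∨ t)  = embed s ∨ embed t

-- Derivability in equational logic. A set of axioms E is given as the relation
-- consisting of all substitution instances of the axioms, so no separate
-- substitution rule is needed.

infix 4 _⊢_≈_ _⊢ᶜ_≈_

data _⊢_≈_ {A : Set a} (E : Rel (SCLTerm A) ℓ) : Rel (SCLTerm A) (a ⊔ ℓ) where
  axiom : ∀ {s t} → E s t → E ⊢ s ≈ t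
  refl  : ∀ {s} → E ⊢ s ≈ s
  sym   : ∀ {s t} → E ⊢ s ≈ t → E ⊢ t ≈ s
  trans : ∀ {s t u} → E ⊢ s ≈ t → E ⊢ t ≈ u → E ⊢ s ≈ u
  ¬-cong : ∀ {s s′} → E ⊢ s ≈ s′ → E ⊢ ¬ s ≈ ¬ s′
  ∧-cong : ∀ {s s′ t t′} → E ⊢ s ≈ s′ → E ⊢ t ≈ t′ → E ⊢ s ∧ t ≈ s′ ∧ t′
  ∨-cong : ∀ {s s′ t t′} → E ⊢ s ≈ s′ → E ⊢ t ≈ t′ → E ⊢ s ∨ t ≈ s′ ∨ t′

data _⊢ᶜ_≈_ {A : Set a} (E : Rel (CTerm A) ℓ) : Rel (CTerm A) (a ⊔ ℓ) where
  axiom : ∀ {s t} → E s t → E ⊢ᶜ s ≈ t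
  refl  : ∀ {s} → E ⊢ᶜ s ≈ s
  sym   : ∀ {s t} → E ⊢ᶜ s ≈ t → E ⊢ᶜ t ≈ s
  trans : ∀ {s t u} → E ⊢ᶜ s ≈ t → E ⊢ᶜ t ≈ u → E ⊢ᶜ s ≈ u
  ¬-cong : ∀ {s s′} → E ⊢ᶜ s ≈ s′ → E ⊢ᶜ ¬ s ≈ ¬ s′
  ∧-cong : ∀ {s s′ t t′} → E ⊢ᶜ s ≈ s′ → E ⊢ᶜ t ≈ t′ → E ⊢ᶜ s ∧ t ≈ s′ ∧ t′
  ∨-cong : ∀ {s s′ t t′} → E ⊢ᶜ s ≈ s′ → E ⊢ᶜ t ≈ t′ → E ⊢ᶜ s ∨ t ≈ s′ ∨ t′
  ◁▷-cong : ∀ {s s′ t t′ u u′} →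
            E ⊢ᶜ s ≈ s′ → E ⊢ᶜ t ≈ t′ → E ⊢ᶜ u ≈ u′ →
            E ⊢ᶜ (s ◁ t ▷ u) ≈ (s′ ◁ t′ ▷ u′)

data CL₂ {A : Set a} : Rel (SCLTerm A) a where
  ¬¬-elim   : ∀ x → CL₂ (¬ ¬ x) x
  deMorgan  : ∀ x y → CL₂ (¬ (x ∧ y)) (¬ x ∨ ¬ y)
  ∧-assoc   : ∀ x y z → CL₂ ((x ∧ y) ∧ z) (x ∧ (y ∧ z))
  ∧-distˡ-∨ : ∀ x y z → CL₂ (x ∧ (y ∨ z)) ((x ∧ y) ∨ (x ∧ z))
  ∧-distʳ-∨ : ∀ x y z → CL₂ ((x ∨ y) ∧ z) ((x ∧ z) ∨ (¬ x ∧ (y ∧ z)))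
  absorb    : ∀ x y → CL₂ (x ∨ (x ∧ y)) x
  ∨-∧-comm  : ∀ x y → CL₂ ((x ∧ y) ∨ (y ∧ x)) ((y ∧ x) ∨ (x ∧ y))
  𝖳-∧       : ∀ x → CL₂ (𝖳 ∧ x) x
  ¬𝖳        : CL₂ (¬ 𝖳) 𝖥

data CP {A : Set a} : Rel (CTerm A) a where
  cp1 : ∀ x y → CP (x ◁ 𝖳 ▷ y) x
  cp2 : ∀ x y → CP (x ◁ 𝖥 ▷ y) y
  cp3 : ∀ x → CP (𝖳 ◁ x ▷ 𝖥) x
  cp4 : ∀ x y z u v →
        CP (x ◁ (y ◁ z ▷ u) ▷ v) ((x ◁ y ▷ v) ◁ z ▷ (x ◁ u ▷ v))

data CPmem {A : Set a} : Rel (CTerm A) a where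
  cp  : CP ⇒ CPmem
  mem : ∀ x y z u v w →
        CPmem (x ◁ y ▷ (z ◁ u ▷ (v ◁ y ▷ w))) (x ◁ y ▷ (z ◁ u ▷ w))

data CPcl {A : Set a} : Rel (CTerm A) a where
  cpmem : CPmem ⇒ CPcl
  cl    : ∀ x y z u v w →
          CPcl ((x ◁ y ▷ z) ◁ u ▷ (v ◁ y ▷ w)) ((x ◁ u ▷ v) ◁ y ▷ (z ◁ u ▷ w))

data CPcl+Def {A : Set a} : Rel (CTerm A) a where
  cpcl  : CPcl ⇒ CPcl+Def
  ¬-def : ∀ x → CPcl+Def (¬ x) (𝖥 ◁ x ▷ 𝖳)
  ∧-def : ∀ x y → CPcl+Def (x ∧ y) (y ◁ x ▷ 𝖥)
  𝖥-def : CPcl+Def 𝖥 (¬ 𝖳)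
  ∨-def : ∀ x y → CPcl+Def (x ∨ y) (¬ (¬ x ∧ ¬ y))

infix 4 CL₂⊢_≈_ CℓSCL₂⊢_≈_

CL₂⊢_≈_ : {A : Set a} → Rel (SCLTerm A) a
CL₂⊢ s ≈ t = CL₂ ⊢ s ≈ t

-- The derivation itself may pass through terms containing the conditional.
CℓSCL₂⊢_≈_ : {A : Set a} → Rel (SCLTerm A) a
CℓSCL₂⊢ s ≈ t = CPcl+Def ⊢ᶜ embed s ≈ embed t

{-# OPTIONS --safe #-}

-- From right to left, a derivation in CℓSCL₂ is translated back to CL₂ by reading
-- x ◁ y ▷ z as (y ∧ x) ∨ (¬ y ∧ z); what has to be shown is that CL₂ proves the
-- axioms of CPcl under this reading. The crucial facts are that ∧ is left regular,
-- x ∧ y ∧ x = x ∧ y, that the two disjuncts of a conditional commute, and that the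
-- "definedness" terms x ∨ 𝖳 commute with each other under ∧; the first two come out
-- of ∨-∧-comm and the third out of its dual. From left to right, every
-- axiom of CL₂ is unfolded to conditionals and derived in CPcl.
module Submission where

open import Function.Bundles using (_⇔_; mk⇔)
open import Level using (Level)
open import Relation.Binary.Bundles using (Setoid)
open import Relation.Binary.PropositionalEquality.Core as ≡ using (_≡_)
import Relation.Binary.Reasoning.Setoid as SetoidReasoning
open import Defs

-- Consequences of the axioms of `CL₂`, beginning with De Morgan duality.

module CL₂-Properties {a : Level} {A : Set a} where

  private
    infix 4 _≈_
    _≈_ : SCLTerm A → SCLTerm A → Set a
    _≈_ = CL₂⊢_≈_

  setoid : Setoid a a
  setoid = record
    { Carrier       = SCLTerm A
    ; _≈_           = _≈_
    ; isEquivalence = record { refl = refl ; sym = sym ; trans = trans }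
    }

  open SetoidReasoning setoid

  ∧-congˡ : ∀ {x y z} → y ≈ z → x ∧ y ≈ x ∧ z
  ∧-congˡ = ∧-cong refl

  ∧-congʳ : ∀ {x y z} → y ≈ z → y ∧ x ≈ z ∧ x
  ∧-congʳ p = ∧-cong p refl

  ∨-congˡ : ∀ {x y z} → y ≈ z → x ∨ y ≈ x ∨ z
  ∨-congˡ = ∨-cong refl

  ∨-congʳ : ∀ {x y z} → y ≈ z → y ∨ x ≈ z ∨ x
  ∨-congʳ p = ∨-cong p refl

  ¬-involutive : ∀ x → ¬ ¬ x ≈ x
  ¬-involutive x = axiom (¬¬-elim x)

  -- The tool for duality: to dualise a law, negate both sides, push the negation inwards and apply
  -- the law to negated arguments.
  ¬-injective : ∀ {x y} → ¬ x ≈ ¬ y → x ≈ y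
  ¬-injective {x} {y} p = begin
    x      ≈⟨ ¬-involutive x ⟨
    ¬ ¬ x  ≈⟨ ¬-cong p ⟩
    ¬ ¬ y  ≈⟨ ¬-involutive y ⟩
    y      ∎

  deMorgan-∧ : ∀ x y → ¬ (x ∧ y) ≈ ¬ x ∨ ¬ y
  deMorgan-∧ x y = axiom (deMorgan x y)

  deMorgan-∨ : ∀ x y → ¬ (x ∨ y) ≈ ¬ x ∧ ¬ y
  deMorgan-∨ x y = ¬-injective (begin
    ¬ ¬ (x ∨ y)      ≈⟨ ¬-involutive _ ⟩
    x ∨ y            ≈⟨ ∨-cong (¬-involutive x) (¬-involutive y) ⟨
    ¬ ¬ x ∨ ¬ ¬ y    ≈⟨ deMorgan-∧ (¬ x) (¬ y) ⟨
    ¬ (¬ x ∧ ¬ y)    ∎)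

  assoc-∧ : ∀ x y z → (x ∧ y) ∧ z ≈ x ∧ (y ∧ z)
  assoc-∧ x y z = axiom (∧-assoc x y z)

  distribˡ-∧-∨ : ∀ x y z → x ∧ (y ∨ z) ≈ (x ∧ y) ∨ (x ∧ z)
  distribˡ-∧-∨ x y z = axiom (∧-distˡ-∨ x y z)

  distribʳ-∧-∨ : ∀ x y z → (x ∨ y) ∧ z ≈ (x ∧ z) ∨ (¬ x ∧ (y ∧ z))
  distribʳ-∧-∨ x y z = axiom (∧-distʳ-∨ x y z)

  absorbs-∨-∧ : ∀ x y → x ∨ (x ∧ y) ≈ x
  absorbs-∨-∧ x y = axiom (absorb x y)

  identityˡ-∧ : ∀ x → 𝖳 ∧ x ≈ x
  identityˡ-∧ x = axiom (𝖳-∧ x)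

  ¬𝖳≈𝖥 : ¬ 𝖳 ≈ 𝖥
  ¬𝖳≈𝖥 = axiom ¬𝖳

  ¬𝖥≈𝖳 : ¬ 𝖥 ≈ 𝖳
  ¬𝖥≈𝖳 = trans (¬-cong (sym ¬𝖳≈𝖥)) (¬-involutive 𝖳)

  assoc-∨ : ∀ x y z → (x ∨ y) ∨ z ≈ x ∨ (y ∨ z)
  assoc-∨ x y z = ¬-injective (begin
    ¬ ((x ∨ y) ∨ z)      ≈⟨ deMorgan-∨ (x ∨ y) z ⟩
    ¬ (x ∨ y) ∧ ¬ z      ≈⟨ ∧-congʳ (deMorgan-∨ x y) ⟩
    (¬ x ∧ ¬ y) ∧ ¬ z    ≈⟨ assoc-∧ (¬ x) (¬ y) (¬ z) ⟩
    ¬ x ∧ (¬ y ∧ ¬ z)    ≈⟨ ∧-congˡ (deMorgan-∨ y z) ⟨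
    ¬ x ∧ ¬ (y ∨ z)      ≈⟨ deMorgan-∨ x (y ∨ z) ⟨
    ¬ (x ∨ (y ∨ z))      ∎)

  distribˡ-∨-∧ : ∀ x y z → x ∨ (y ∧ z) ≈ (x ∨ y) ∧ (x ∨ z)
  distribˡ-∨-∧ x y z = ¬-injective (begin
    ¬ (x ∨ (y ∧ z))              ≈⟨ deMorgan-∨ x (y ∧ z) ⟩
    ¬ x ∧ ¬ (y ∧ z)              ≈⟨ ∧-congˡ (deMorgan-∧ y z) ⟩
    ¬ x ∧ (¬ y ∨ ¬ z)            ≈⟨ distribˡ-∧-∨ (¬ x) (¬ y) (¬ z) ⟩
    (¬ x ∧ ¬ y) ∨ (¬ x ∧ ¬ z)    ≈⟨ ∨-cong (deMorgan-∨ x y) (deMorgan-∨ x z) ⟨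
    ¬ (x ∨ y) ∨ ¬ (x ∨ z)        ≈⟨ deMorgan-∧ (x ∨ y) (x ∨ z) ⟨
    ¬ ((x ∨ y) ∧ (x ∨ z))        ∎)

  distribʳ-∨-∧ : ∀ x y z → (x ∧ y) ∨ z ≈ (x ∨ z) ∧ (¬ x ∨ (y ∨ z))
  distribʳ-∨-∧ x y z = ¬-injective (begin
    ¬ ((x ∧ y) ∨ z)                        ≈⟨ deMorgan-∨ (x ∧ y) z ⟩
    ¬ (x ∧ y) ∧ ¬ z                        ≈⟨ ∧-congʳ (deMorgan-∧ x y) ⟩
    (¬ x ∨ ¬ y) ∧ ¬ z                      ≈⟨ distribʳ-∧-∨ (¬ x) (¬ y) (¬ z) ⟩
    (¬ x ∧ ¬ z) ∨ (¬ ¬ x ∧ (¬ y ∧ ¬ z))    ≈⟨ ∨-cong (deMorgan-∨ x z) (∧-congˡ (deMorgan-∨ y z)) ⟨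
    ¬ (x ∨ z) ∨ (¬ ¬ x ∧ ¬ (y ∨ z))        ≈⟨ ∨-congˡ (deMorgan-∨ (¬ x) (y ∨ z)) ⟨
    ¬ (x ∨ z) ∨ ¬ (¬ x ∨ (y ∨ z))          ≈⟨ deMorgan-∧ (x ∨ z) (¬ x ∨ (y ∨ z)) ⟨
    ¬ ((x ∨ z) ∧ (¬ x ∨ (y ∨ z)))          ∎)

  absorbs-∧-∨ : ∀ x y → x ∧ (x ∨ y) ≈ x
  absorbs-∧-∨ x y = ¬-injective (begin
    ¬ (x ∧ (x ∨ y))        ≈⟨ deMorgan-∧ x (x ∨ y) ⟩
    ¬ x ∨ ¬ (x ∨ y)        ≈⟨ ∨-congˡ (deMorgan-∨ x y) ⟩
    ¬ x ∨ (¬ x ∧ ¬ y)      ≈⟨ absorbs-∨-∧ (¬ x) (¬ y) ⟩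
    ¬ x                    ∎)

  ∧-∨-comm : ∀ x y → (x ∨ y) ∧ (y ∨ x) ≈ (y ∨ x) ∧ (x ∨ y)
  ∧-∨-comm x y = ¬-injective (begin
    ¬ ((x ∨ y) ∧ (y ∨ x))        ≈⟨ expand x y ⟩
    (¬ x ∧ ¬ y) ∨ (¬ y ∧ ¬ x)    ≈⟨ axiom (∨-∧-comm (¬ x) (¬ y)) ⟩
    (¬ y ∧ ¬ x) ∨ (¬ x ∧ ¬ y)    ≈⟨ expand y x ⟨
    ¬ ((y ∨ x) ∧ (x ∨ y))        ∎)
    where
    expand : ∀ x y → ¬ ((x ∨ y) ∧ (y ∨ x)) ≈ (¬ x ∧ ¬ y) ∨ (¬ y ∧ ¬ x)
    expand x y = trans (deMorgan-∧ (x ∨ y) (y ∨ x)) (∨-cong (deMorgan-∨ x y) (deMorgan-∨ y x))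

  -- Units and zeros.

  zeroˡ-∨ : ∀ x → 𝖳 ∨ x ≈ 𝖳
  zeroˡ-∨ x = begin
    𝖳 ∨ x          ≈⟨ ∨-congˡ (identityˡ-∧ x) ⟨
    𝖳 ∨ (𝖳 ∧ x)    ≈⟨ absorbs-∨-∧ 𝖳 x ⟩
    𝖳              ∎

  zeroˡ-∧ : ∀ x → 𝖥 ∧ x ≈ 𝖥
  zeroˡ-∧ x = ¬-injective (begin
    ¬ (𝖥 ∧ x)      ≈⟨ deMorgan-∧ 𝖥 x ⟩
    ¬ 𝖥 ∨ ¬ x      ≈⟨ ∨-congʳ ¬𝖥≈𝖳 ⟩
    𝖳 ∨ ¬ x        ≈⟨ zeroˡ-∨ (¬ x) ⟩
    𝖳              ≈⟨ ¬𝖥≈𝖳 ⟨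
    ¬ 𝖥            ∎)

  identityˡ-∨ : ∀ x → 𝖥 ∨ x ≈ x
  identityˡ-∨ x = ¬-injective (begin
    ¬ (𝖥 ∨ x)    ≈⟨ deMorgan-∨ 𝖥 x ⟩
    ¬ 𝖥 ∧ ¬ x    ≈⟨ ∧-congʳ ¬𝖥≈𝖳 ⟩
    𝖳 ∧ ¬ x      ≈⟨ identityˡ-∧ (¬ x) ⟩
    ¬ x          ∎)

  -- Right distributivity applied to `(𝖳 ∨ 𝖳) ∧ x` produces a second disjunct headed by `¬ 𝖳`, which
  -- collapses to `𝖥`.
  identityʳ-∨ : ∀ x → x ∨ 𝖥 ≈ x
  identityʳ-∨ x = begin
    x ∨ 𝖥                      ≈⟨ ∨-cong (identityˡ-∧ x) (zeroˡ-∧ (𝖳 ∧ x)) ⟨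
    (𝖳 ∧ x) ∨ (𝖥 ∧ (𝖳 ∧ x))    ≈⟨ ∨-congˡ (∧-congʳ ¬𝖳≈𝖥) ⟨
    (𝖳 ∧ x) ∨ (¬ 𝖳 ∧ (𝖳 ∧ x))  ≈⟨ distribʳ-∧-∨ 𝖳 𝖳 x ⟨
    (𝖳 ∨ 𝖳) ∧ x                ≈⟨ ∧-congʳ (zeroˡ-∨ 𝖳) ⟩
    𝖳 ∧ x                      ≈⟨ identityˡ-∧ x ⟩
    x                          ∎

  identityʳ-∧ : ∀ x → x ∧ 𝖳 ≈ x
  identityʳ-∧ x = ¬-injective (begin
    ¬ (x ∧ 𝖳)    ≈⟨ deMorgan-∧ x 𝖳 ⟩
    ¬ x ∨ ¬ 𝖳    ≈⟨ ∨-congˡ ¬𝖳≈𝖥 ⟩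
    ¬ x ∨ 𝖥      ≈⟨ identityʳ-∨ (¬ x) ⟩
    ¬ x          ∎)

  -- Idempotence and left regularity.

  idem-∧ : ∀ x → x ∧ x ≈ x
  idem-∧ x = trans (∧-congˡ (sym (absorbs-∨-∧ x x))) (absorbs-∧-∨ x (x ∧ x))

  idem-∨ : ∀ x → x ∨ x ≈ x
  idem-∨ x = trans (∨-congˡ (sym (idem-∧ x))) (absorbs-∨-∧ x x)

  x∧[x∧y]≈x∧y : ∀ x y → x ∧ (x ∧ y) ≈ x ∧ y
  x∧[x∧y]≈x∧y x y = trans (sym (assoc-∧ x x y)) (∧-congʳ (idem-∧ x))

  -- With `p = x ∧ y`, absorption and distributivity turn `p ∧ x` into `(p ∧ x) ∨ (x ∧ p)`.
  -- Commuting the disjuncts puts `x ∧ p`, which is `p`, first, and then `p` absorbs `p ∧ x`.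
  leftRegular-∧ : ∀ x y → (x ∧ y) ∧ x ≈ x ∧ y
  leftRegular-∧ x y = begin
    p ∧ x                  ≈⟨ ∧-congˡ (absorbs-∨-∧ x y) ⟨
    p ∧ (x ∨ p)            ≈⟨ distribˡ-∧-∨ p x p ⟩
    (p ∧ x) ∨ (p ∧ p)      ≈⟨ ∨-congˡ (trans (idem-∧ p) (sym (x∧[x∧y]≈x∧y x y))) ⟩
    (p ∧ x) ∨ (x ∧ p)      ≈⟨ axiom (∨-∧-comm p x) ⟩
    (x ∧ p) ∨ (p ∧ x)      ≈⟨ ∨-congʳ (x∧[x∧y]≈x∧y x y) ⟩
    p ∨ (p ∧ x)            ≈⟨ absorbs-∨-∧ p x ⟩
    p                      ∎
    where p = x ∧ y

  leftRegular-∨ : ∀ x y → (x ∨ y) ∨ x ≈ x ∨ y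
  leftRegular-∨ x y = ¬-injective (begin
    ¬ ((x ∨ y) ∨ x)      ≈⟨ deMorgan-∨ (x ∨ y) x ⟩
    ¬ (x ∨ y) ∧ ¬ x      ≈⟨ ∧-congʳ (deMorgan-∨ x y) ⟩
    (¬ x ∧ ¬ y) ∧ ¬ x    ≈⟨ leftRegular-∧ (¬ x) (¬ y) ⟩
    ¬ x ∧ ¬ y            ≈⟨ deMorgan-∨ x y ⟨
    ¬ (x ∨ y)            ∎)

  -- Complements.

  -- Expanding `(x ∧ 𝖥) ∨ 𝖥` by the dual of right distributivity gives the left-hand side. The
  -- right-hand side cannot be just `𝖥`, since an undefined `x` stays undefined.
  x∧¬x≈x∧𝖥 : ∀ x → x ∧ ¬ x ≈ x ∧ 𝖥
  x∧¬x≈x∧𝖥 x = begin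
    x ∧ ¬ x                      ≈⟨ ∧-cong (identityʳ-∨ x) (trans (∨-congˡ (identityˡ-∨ 𝖥)) (identityʳ-∨ (¬ x))) ⟨
    (x ∨ 𝖥) ∧ (¬ x ∨ (𝖥 ∨ 𝖥))    ≈⟨ distribʳ-∨-∧ x 𝖥 𝖥 ⟨
    (x ∧ 𝖥) ∨ 𝖥                  ≈⟨ identityʳ-∨ (x ∧ 𝖥) ⟩
    x ∧ 𝖥                        ∎

  x∧[¬x∧y]≈x∧𝖥 : ∀ x y → x ∧ (¬ x ∧ y) ≈ x ∧ 𝖥
  x∧[¬x∧y]≈x∧𝖥 x y = begin
    x ∧ (¬ x ∧ y)    ≈⟨ assoc-∧ x (¬ x) y ⟨
    (x ∧ ¬ x) ∧ y    ≈⟨ ∧-congʳ (x∧¬x≈x∧𝖥 x) ⟩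
    (x ∧ 𝖥) ∧ y      ≈⟨ assoc-∧ x 𝖥 y ⟩
    x ∧ (𝖥 ∧ y)      ≈⟨ ∧-congˡ (zeroˡ-∧ y) ⟩
    x ∧ 𝖥            ∎

  -- Left regularity carries a copy of `x` past `y`, where it meets `¬ x`.
  x∧[y∧[¬x∧z]]≈x∧[y∧𝖥] : ∀ x y z → x ∧ (y ∧ (¬ x ∧ z)) ≈ x ∧ (y ∧ 𝖥)
  x∧[y∧[¬x∧z]]≈x∧[y∧𝖥] x y z = begin
    x ∧ (y ∧ (¬ x ∧ z))      ≈⟨ assoc-∧ x y (¬ x ∧ z) ⟨
    (x ∧ y) ∧ (¬ x ∧ z)      ≈⟨ ∧-congʳ (leftRegular-∧ x y) ⟨
    ((x ∧ y) ∧ x) ∧ (¬ x ∧ z) ≈⟨ assoc-∧ (x ∧ y) x (¬ x ∧ z) ⟩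
    (x ∧ y) ∧ (x ∧ (¬ x ∧ z)) ≈⟨ ∧-congˡ (x∧[¬x∧y]≈x∧𝖥 x z) ⟩
    (x ∧ y) ∧ (x ∧ 𝖥)        ≈⟨ assoc-∧ (x ∧ y) x 𝖥 ⟨
    ((x ∧ y) ∧ x) ∧ 𝖥        ≈⟨ ∧-congʳ (leftRegular-∧ x y) ⟩
    (x ∧ y) ∧ 𝖥              ≈⟨ assoc-∧ x y 𝖥 ⟩
    x ∧ (y ∧ 𝖥)              ∎

  x∧[¬x∨y]≈x∧y : ∀ x y → x ∧ (¬ x ∨ y) ≈ x ∧ y
  x∧[¬x∨y]≈x∧y x y = begin
    x ∧ (¬ x ∨ y)          ≈⟨ distribˡ-∧-∨ x (¬ x) y ⟩
    (x ∧ ¬ x) ∨ (x ∧ y)    ≈⟨ ∨-congʳ (x∧¬x≈x∧𝖥 x) ⟩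
    (x ∧ 𝖥) ∨ (x ∧ y)      ≈⟨ distribˡ-∧-∨ x 𝖥 y ⟨
    x ∧ (𝖥 ∨ y)            ≈⟨ ∧-congˡ (identityˡ-∨ y) ⟩
    x ∧ y                  ∎

  x∨[¬x∧y]≈x∨y : ∀ x y → x ∨ (¬ x ∧ y) ≈ x ∨ y
  x∨[¬x∧y]≈x∨y x y = ¬-injective (begin
    ¬ (x ∨ (¬ x ∧ y))        ≈⟨ deMorgan-∨ x (¬ x ∧ y) ⟩
    ¬ x ∧ ¬ (¬ x ∧ y)        ≈⟨ ∧-congˡ (deMorgan-∧ (¬ x) y) ⟩
    ¬ x ∧ (¬ ¬ x ∨ ¬ y)      ≈⟨ x∧[¬x∨y]≈x∧y (¬ x) (¬ y) ⟩
    ¬ x ∧ ¬ y                ≈⟨ deMorgan-∨ x y ⟨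
    ¬ (x ∨ y)                ∎)

  -- The conditional as a term of `CL₂`.

  [x∧y]∨[¬x∧𝖥]≈x∧y : ∀ x y → (x ∧ y) ∨ (¬ x ∧ 𝖥) ≈ x ∧ y
  [x∧y]∨[¬x∧𝖥]≈x∧y x y = begin
    (x ∧ y) ∨ (¬ x ∧ 𝖥)          ≈⟨ ∨-congˡ (∧-congˡ (zeroˡ-∧ y)) ⟨
    (x ∧ y) ∨ (¬ x ∧ (𝖥 ∧ y))    ≈⟨ distribʳ-∧-∨ x 𝖥 y ⟨
    (x ∨ 𝖥) ∧ y                  ≈⟨ ∧-congʳ (identityʳ-∨ x) ⟩
    x ∧ y                        ∎

  -- x ⁇ y ∶ z stands for y ◁ x ▷ z.
  infix 5 _⁇_∶_
  _⁇_∶_ : SCLTerm A → SCLTerm A → SCLTerm A → SCLTerm A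
  x ⁇ y ∶ z = (x ∧ y) ∨ (¬ x ∧ z)

  ⁇∶-cong : ∀ {x x′ y y′ z z′} → x ≈ x′ → y ≈ y′ → z ≈ z′ → (x ⁇ y ∶ z) ≈ (x′ ⁇ y′ ∶ z′)
  ⁇∶-cong p q r = ∨-cong (∧-cong p q) (∧-cong (¬-cong p) r)

  -- Dual right distributivity gives two conjuncts; left regularity of `∨` and absorption then
  -- remove `¬ x ∧ z` from the second.
  ⁇∶-conjunctive : ∀ x y z → (x ⁇ y ∶ z) ≈ (x ∨ z) ∧ (¬ x ∨ y)
  ⁇∶-conjunctive x y z = begin
    (x ∧ y) ∨ (¬ x ∧ z)                                    ≈⟨ distribʳ-∨-∧ x y (¬ x ∧ z) ⟩
    (x ∨ (¬ x ∧ z)) ∧ (¬ x ∨ (y ∨ (¬ x ∧ z)))              ≈⟨ ∧-cong (x∨[¬x∧y]≈x∨y x z) (sym (assoc-∨ (¬ x) y (¬ x ∧ z))) ⟩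
    (x ∨ z) ∧ ((¬ x ∨ y) ∨ (¬ x ∧ z))                      ≈⟨ ∧-congˡ (distribˡ-∨-∧ (¬ x ∨ y) (¬ x) z) ⟩
    (x ∨ z) ∧ (((¬ x ∨ y) ∨ ¬ x) ∧ ((¬ x ∨ y) ∨ z))        ≈⟨ ∧-congˡ (∧-congʳ (leftRegular-∨ (¬ x) y)) ⟩
    (x ∨ z) ∧ ((¬ x ∨ y) ∧ ((¬ x ∨ y) ∨ z))                ≈⟨ ∧-congˡ (absorbs-∧-∨ (¬ x ∨ y) z) ⟩
    (x ∨ z) ∧ (¬ x ∨ y)                                    ∎

  -- Both disjunctions p ∨ q and q ∨ p have a conjunctive form, with the same two
  -- conjuncts in opposite order, so that ∨-∧-comm applies to them.
  ⁇∶-comm : ∀ x y z → (x ⁇ y ∶ z) ≈ (¬ x ∧ z) ∨ (x ∧ y)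
  ⁇∶-comm x y z = begin
    p ∨ q                ≈⟨ collapse p q ⟨
    (p ∨ q) ∨ (q ∨ p)    ≈⟨ ∨-cong p∨q≈r∧s q∨p≈s∧r ⟩
    (r ∧ s) ∨ (s ∧ r)    ≈⟨ axiom (∨-∧-comm r s) ⟩
    (s ∧ r) ∨ (r ∧ s)    ≈⟨ ∨-cong q∨p≈s∧r p∨q≈r∧s ⟨
    (q ∨ p) ∨ (p ∨ q)    ≈⟨ collapse q p ⟩
    q ∨ p                ∎
    where
    p = x ∧ y
    q = ¬ x ∧ z
    r = x ∨ z
    s = ¬ x ∨ y

    p∨q≈r∧s : p ∨ q ≈ r ∧ s
    p∨q≈r∧s = ⁇∶-conjunctive x y z

    q∨p≈s∧r : q ∨ p ≈ s ∧ r
    q∨p≈s∧r = begin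
      q ∨ p                        ≈⟨ ∨-congˡ (∧-congʳ (¬-involutive x)) ⟨
      (¬ x ∧ z) ∨ (¬ ¬ x ∧ y)      ≈⟨ ⁇∶-conjunctive (¬ x) z y ⟩
      (¬ x ∨ y) ∧ (¬ ¬ x ∨ z)      ≈⟨ ∧-congˡ (∨-congʳ (¬-involutive x)) ⟩
      s ∧ r                        ∎

    collapse : ∀ u v → (u ∨ v) ∨ (v ∨ u) ≈ u ∨ v
    collapse u v = begin
      (u ∨ v) ∨ (v ∨ u)    ≈⟨ assoc-∨ (u ∨ v) v u ⟨
      ((u ∨ v) ∨ v) ∨ u    ≈⟨ ∨-congʳ (trans (assoc-∨ u v v) (∨-congˡ (idem-∨ v))) ⟩
      (u ∨ v) ∨ u          ≈⟨ leftRegular-∨ u v ⟩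
      u ∨ v                ∎

  -- The disjuncts are swapped first, so that De Morgan yields the conjuncts in the order of
  -- `⁇∶-conjunctive`.
  ¬-distrib-⁇∶ : ∀ x y z → ¬ (x ⁇ y ∶ z) ≈ (x ⁇ ¬ y ∶ ¬ z)
  ¬-distrib-⁇∶ x y z = begin
    ¬ (x ⁇ y ∶ z)                      ≈⟨ ¬-cong (⁇∶-comm x y z) ⟩
    ¬ ((¬ x ∧ z) ∨ (x ∧ y))            ≈⟨ deMorgan-∨ (¬ x ∧ z) (x ∧ y) ⟩
    ¬ (¬ x ∧ z) ∧ ¬ (x ∧ y)            ≈⟨ ∧-cong (deMorgan-∧ (¬ x) z) (deMorgan-∧ x y) ⟩
    (¬ ¬ x ∨ ¬ z) ∧ (¬ x ∨ ¬ y)        ≈⟨ ∧-congʳ (∨-congʳ (¬-involutive x)) ⟩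
    (x ∨ ¬ z) ∧ (¬ x ∨ ¬ y)            ≈⟨ ⁇∶-conjunctive x (¬ y) (¬ z) ⟨
    (x ⁇ ¬ y ∶ ¬ z)                    ∎

  -- Right distributivity leaves a surplus disjunct `x ∧ (¬ y ∧ q)`. As `q` begins with `¬ x`, it
  -- shrinks to `x ∧ (¬ y ∧ 𝖥)`, and once `p` is moved next to it by `⁇∶-comm`, `p` swallows it.
  ⁇∶-distribʳ-∧ : ∀ w x y z → (x ⁇ y ∶ z) ∧ w ≈ (x ⁇ y ∧ w ∶ z ∧ w)
  ⁇∶-distribʳ-∧ w x y z = begin
    ((x ∧ y) ∨ (¬ x ∧ z)) ∧ w                           ≈⟨ distribʳ-∧-∨ (x ∧ y) (¬ x ∧ z) w ⟩
    ((x ∧ y) ∧ w) ∨ (¬ (x ∧ y) ∧ ((¬ x ∧ z) ∧ w))       ≈⟨ ∨-cong (assoc-∧ x y w) (∧-cong (deMorgan-∧ x y) (assoc-∧ (¬ x) z w)) ⟩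
    p ∨ ((¬ x ∨ ¬ y) ∧ q)                               ≈⟨ ∨-congˡ (distribʳ-∧-∨ (¬ x) (¬ y) q) ⟩
    p ∨ ((¬ x ∧ q) ∨ (¬ ¬ x ∧ (¬ y ∧ q)))               ≈⟨ ∨-congˡ (∨-cong (x∧[x∧y]≈x∧y (¬ x) (z ∧ w)) (∧-congʳ (¬-involutive x))) ⟩
    p ∨ (q ∨ (x ∧ (¬ y ∧ q)))                           ≈⟨ ∨-congˡ (∨-congˡ (x∧[y∧[¬x∧z]]≈x∧[y∧𝖥] x (¬ y) (z ∧ w))) ⟩
    p ∨ (q ∨ (x ∧ (¬ y ∧ 𝖥)))                           ≈⟨ assoc-∨ p q (x ∧ (¬ y ∧ 𝖥)) ⟨
    (p ∨ q) ∨ (x ∧ (¬ y ∧ 𝖥))                           ≈⟨ ∨-congʳ (⁇∶-comm x (y ∧ w) (z ∧ w)) ⟩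
    (q ∨ p) ∨ (x ∧ (¬ y ∧ 𝖥))                           ≈⟨ assoc-∨ q p (x ∧ (¬ y ∧ 𝖥)) ⟩
    q ∨ (p ∨ (x ∧ (¬ y ∧ 𝖥)))                           ≈⟨ ∨-congˡ (distribˡ-∧-∨ x (y ∧ w) (¬ y ∧ 𝖥)) ⟨
    q ∨ (x ∧ ((y ∧ w) ∨ (¬ y ∧ 𝖥)))                     ≈⟨ ∨-congˡ (∧-congˡ ([x∧y]∨[¬x∧𝖥]≈x∧y y w)) ⟩
    q ∨ p                                               ≈⟨ ⁇∶-comm x (y ∧ w) (z ∧ w) ⟨
    p ∨ q                                               ∎
    where
    p = x ∧ (y ∧ w)
    q = ¬ x ∧ (z ∧ w)

  x∧⁇∶ : ∀ x y z → x ∧ (x ⁇ y ∶ z) ≈ x ∧ y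
  x∧⁇∶ x y z = begin
    x ∧ ((x ∧ y) ∨ (¬ x ∧ z))            ≈⟨ distribˡ-∧-∨ x (x ∧ y) (¬ x ∧ z) ⟩
    (x ∧ (x ∧ y)) ∨ (x ∧ (¬ x ∧ z))      ≈⟨ ∨-cong (x∧[x∧y]≈x∧y x y) (x∧[¬x∧y]≈x∧𝖥 x z) ⟩
    (x ∧ y) ∨ (x ∧ 𝖥)                    ≈⟨ distribˡ-∧-∨ x y 𝖥 ⟨
    x ∧ (y ∨ 𝖥)                          ≈⟨ ∧-congˡ (identityʳ-∨ y) ⟩
    x ∧ y                                ∎

  ¬x∧⁇∶ : ∀ x y z → ¬ x ∧ (x ⁇ y ∶ z) ≈ ¬ x ∧ z
  ¬x∧⁇∶ x y z = begin
    ¬ x ∧ (x ⁇ y ∶ z)                  ≈⟨ ∧-congˡ (⁇∶-comm x y z) ⟩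
    ¬ x ∧ ((¬ x ∧ z) ∨ (x ∧ y))        ≈⟨ ∧-congˡ (∨-congˡ (∧-congʳ (¬-involutive x))) ⟨
    ¬ x ∧ (¬ x ⁇ z ∶ y)                ≈⟨ x∧⁇∶ (¬ x) z y ⟩
    ¬ x ∧ z                            ∎

  -- The outcome of `x` is remembered across `y`: left regularity places a second `x` directly
  -- before the conditional.
  x∧[y∧⁇∶] : ∀ x y z w → x ∧ (y ∧ (x ⁇ z ∶ w)) ≈ x ∧ (y ∧ z)
  x∧[y∧⁇∶] x y z w = begin
    x ∧ (y ∧ (x ⁇ z ∶ w))            ≈⟨ recall (x ⁇ z ∶ w) ⟩
    (x ∧ y) ∧ (x ∧ (x ⁇ z ∶ w))      ≈⟨ ∧-congˡ (x∧⁇∶ x z w) ⟩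
    (x ∧ y) ∧ (x ∧ z)                ≈⟨ recall z ⟨
    x ∧ (y ∧ z)                      ∎
    where
    recall : ∀ u → x ∧ (y ∧ u) ≈ (x ∧ y) ∧ (x ∧ u)
    recall u = begin
      x ∧ (y ∧ u)          ≈⟨ assoc-∧ x y u ⟨
      (x ∧ y) ∧ u          ≈⟨ ∧-congʳ (leftRegular-∧ x y) ⟨
      ((x ∧ y) ∧ x) ∧ u    ≈⟨ assoc-∧ (x ∧ y) x u ⟩
      (x ∧ y) ∧ (x ∧ u)    ∎

  ¬x∧[y∧⁇∶] : ∀ x y z w → ¬ x ∧ (y ∧ (x ⁇ z ∶ w)) ≈ ¬ x ∧ (y ∧ w)
  ¬x∧[y∧⁇∶] x y z w = begin
    ¬ x ∧ (y ∧ (x ⁇ z ∶ w))                  ≈⟨ ∧-congˡ (∧-congˡ (⁇∶-comm x z w)) ⟩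
    ¬ x ∧ (y ∧ ((¬ x ∧ w) ∨ (x ∧ z)))        ≈⟨ ∧-congˡ (∧-congˡ (∨-congˡ (∧-congʳ (¬-involutive x)))) ⟨
    ¬ x ∧ (y ∧ (¬ x ⁇ w ∶ z))                ≈⟨ x∧[y∧⁇∶] (¬ x) y w z ⟩
    ¬ x ∧ (y ∧ w)                            ∎

  -- The axioms of `CPcl` for this conditional.

  ⁇∶-𝖳 : ∀ x y → (𝖳 ⁇ x ∶ y) ≈ x
  ⁇∶-𝖳 x y = begin
    (𝖳 ∧ x) ∨ (¬ 𝖳 ∧ y)    ≈⟨ ∨-cong (identityˡ-∧ x) (trans (∧-congʳ ¬𝖳≈𝖥) (zeroˡ-∧ y)) ⟩
    x ∨ 𝖥                  ≈⟨ identityʳ-∨ x ⟩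
    x                      ∎

  ⁇∶-𝖥 : ∀ x y → (𝖥 ⁇ x ∶ y) ≈ y
  ⁇∶-𝖥 x y = begin
    (𝖥 ∧ x) ∨ (¬ 𝖥 ∧ y)    ≈⟨ ∨-cong (zeroˡ-∧ x) (trans (∧-congʳ ¬𝖥≈𝖳) (identityˡ-∧ y)) ⟩
    𝖥 ∨ y                  ≈⟨ identityˡ-∨ y ⟩
    y                      ∎

  ⁇∶-𝖳𝖥 : ∀ x → (x ⁇ 𝖳 ∶ 𝖥) ≈ x
  ⁇∶-𝖳𝖥 x = trans ([x∧y]∨[¬x∧𝖥]≈x∧y x 𝖳) (identityʳ-∧ x)

  ⁇∶-𝖥𝖳 : ∀ x → (x ⁇ 𝖥 ∶ 𝖳) ≈ ¬ x
  ⁇∶-𝖥𝖳 x = begin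
    (x ∧ 𝖥) ∨ (¬ x ∧ 𝖳)        ≈⟨ ⁇∶-comm x 𝖥 𝖳 ⟩
    (¬ x ∧ 𝖳) ∨ (x ∧ 𝖥)        ≈⟨ ∨-congˡ (∧-congʳ (¬-involutive x)) ⟨
    (¬ x ⁇ 𝖳 ∶ 𝖥)              ≈⟨ ⁇∶-𝖳𝖥 (¬ x) ⟩
    ¬ x                        ∎

  -- Both sides are disjunctions of `p`, `q`, `r`, `s`, with `q` and `r` in different order. These
  -- two are guarded by `¬ z` and `z`, so `⁇∶-comm` swaps them.
  ⁇∶-nested : ∀ x y z u v → ((z ⁇ y ∶ u) ⁇ x ∶ v) ≈ (z ⁇ (y ⁇ x ∶ v) ∶ (u ⁇ x ∶ v))
  ⁇∶-nested x y z u v = begin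
    ((z ⁇ y ∶ u) ∧ x) ∨ (¬ (z ⁇ y ∶ u) ∧ v)      ≈⟨ ∨-congˡ (∧-congʳ (¬-distrib-⁇∶ z y u)) ⟩
    ((z ⁇ y ∶ u) ∧ x) ∨ ((z ⁇ ¬ y ∶ ¬ u) ∧ v)    ≈⟨ ∨-cong (⁇∶-distribʳ-∧ x z y u) (⁇∶-distribʳ-∧ v z (¬ y) (¬ u)) ⟩
    (p ∨ q) ∨ (r ∨ s)                            ≈⟨ assoc-∨ p q (r ∨ s) ⟩
    p ∨ (q ∨ (r ∨ s))                            ≈⟨ ∨-congˡ (assoc-∨ q r s) ⟨
    p ∨ ((q ∨ r) ∨ s)                            ≈⟨ ∨-congˡ (∨-congʳ (⁇∶-comm z (¬ y ∧ v) (u ∧ x))) ⟨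
    p ∨ ((r ∨ q) ∨ s)                            ≈⟨ ∨-congˡ (assoc-∨ r q s) ⟩
    p ∨ (r ∨ (q ∨ s))                            ≈⟨ assoc-∨ p r (q ∨ s) ⟨
    (p ∨ r) ∨ (q ∨ s)                            ≈⟨ ∨-cong (distribˡ-∧-∨ z (y ∧ x) (¬ y ∧ v)) (distribˡ-∧-∨ (¬ z) (u ∧ x) (¬ u ∧ v)) ⟨
    (z ⁇ (y ⁇ x ∶ v) ∶ (u ⁇ x ∶ v))              ∎
    where
    p = z ∧ (y ∧ x)
    q = ¬ z ∧ (u ∧ x)
    r = z ∧ (¬ y ∧ v)
    s = ¬ z ∧ (¬ u ∧ v)

  ⁇∶-memorise : ∀ x y z u v w → (y ⁇ x ∶ (u ⁇ z ∶ (y ⁇ v ∶ w))) ≈ (y ⁇ x ∶ (u ⁇ z ∶ w))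
  ⁇∶-memorise x y z u v w = ∨-congˡ (begin
    ¬ y ∧ (u ⁇ z ∶ (y ⁇ v ∶ w))                          ≈⟨ distribˡ-∧-∨ (¬ y) (u ∧ z) _ ⟩
    (¬ y ∧ (u ∧ z)) ∨ (¬ y ∧ (¬ u ∧ (y ⁇ v ∶ w)))        ≈⟨ ∨-congˡ (¬x∧[y∧⁇∶] y (¬ u) v w) ⟩
    (¬ y ∧ (u ∧ z)) ∨ (¬ y ∧ (¬ u ∧ w))                  ≈⟨ distribˡ-∧-∨ (¬ y) (u ∧ z) _ ⟨
    ¬ y ∧ (u ⁇ z ∶ w)                                    ∎)

  -- In three-valued terms x ∨ 𝖳 is true if x has a truth value, and undefined
  -- otherwise.
  defined : SCLTerm A → SCLTerm A
  defined x = x ∨ 𝖳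

  -- Turns a definedness guard into a case distinction, whose branches can then be rewritten
  -- separately.
  defined-∧ : ∀ x y → defined x ∧ y ≈ (x ⁇ y ∶ y)
  defined-∧ x y = trans (distribʳ-∧-∨ x 𝖳 y) (∨-congˡ (∧-congˡ (identityˡ-∧ y)))

  -- A term `u ∨ 𝖳` absorbs every further disjunct, so in `∧-∨-comm` for two such terms each
  -- disjunction reduces to its first member.
  defined-∧-comm : ∀ x y → defined x ∧ defined y ≈ defined y ∧ defined x
  defined-∧-comm x y = begin
    defined x ∧ defined y                                ≈⟨ ∧-cong (absorbed x (defined y)) (absorbed y (defined x)) ⟨
    (defined x ∨ defined y) ∧ (defined y ∨ defined x)    ≈⟨ ∧-∨-comm (defined x) (defined y) ⟩
    (defined y ∨ defined x) ∧ (defined x ∨ defined y)    ≈⟨ ∧-cong (absorbed y (defined x)) (absorbed x (defined y)) ⟩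
    defined y ∧ defined x                                ∎
    where
    absorbed : ∀ u v → defined u ∨ v ≈ defined u
    absorbed u v = trans (assoc-∨ u 𝖳 v) (∨-congˡ (zeroˡ-∨ v))

  defined-∧-defined-∧ : ∀ x y z →
    defined x ∧ (defined y ∧ z) ≈ (x ⁇ (y ⁇ z ∶ z) ∶ (y ⁇ z ∶ z))
  defined-∧-defined-∧ x y z = trans (∧-congˡ (defined-∧ y z)) (defined-∧ x (y ⁇ z ∶ z))

  -- Guarding the right-hand side r by the definedness of u and y allows a case
  -- distinction on u and y in either order: one order gives the left-hand side,
  -- the other gives r back.
  ⁇∶-exchange : ∀ x y z u v w →
    (u ⁇ (y ⁇ x ∶ z) ∶ (y ⁇ v ∶ w)) ≈ (y ⁇ (u ⁇ x ∶ v) ∶ (u ⁇ z ∶ w))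
  ⁇∶-exchange x y z u v w = begin
    -- Under the guards `u`, `y` the inner `y` first reduces `r` to `p` or `q`; the value of `u`,
    -- remembered across `y`, then selects the leaf.
    (u ⁇ (y ⁇ x ∶ z) ∶ (y ⁇ v ∶ w))      ≈⟨ ∨-cong
        (cases u (trans (∧-congˡ (x∧⁇∶ y p q)) (x∧[y∧⁇∶] u y x v))
                 (trans (∧-congˡ (¬x∧⁇∶ y p q)) (x∧[y∧⁇∶] u (¬ y) z w)))
        (cases (¬ u) (trans (∧-congˡ (x∧⁇∶ y p q)) (¬x∧[y∧⁇∶] u y x v))
                     (trans (∧-congˡ (¬x∧⁇∶ y p q)) (¬x∧[y∧⁇∶] u (¬ y) z w))) ⟨
    (u ⁇ (y ⁇ r ∶ r) ∶ (y ⁇ r ∶ r))      ≈⟨ defined-∧-defined-∧ u y r ⟨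
    defined u ∧ (defined y ∧ r)          ≈⟨ assoc-∧ (defined u) (defined y) r ⟨
    (defined u ∧ defined y) ∧ r          ≈⟨ ∧-congʳ (defined-∧-comm u y) ⟩
    (defined y ∧ defined u) ∧ r          ≈⟨ assoc-∧ (defined y) (defined u) r ⟩
    defined y ∧ (defined u ∧ r)          ≈⟨ defined-∧-defined-∧ y u r ⟩
    -- Here `y` is the remembered guard that reduces `r`, and the adjacent `u` selects the leaf.
    (y ⁇ (u ⁇ r ∶ r) ∶ (u ⁇ r ∶ r))      ≈⟨ ∨-cong
        (cases y (trans (x∧[y∧⁇∶] y u p q) (∧-congˡ (x∧⁇∶ u x v)))
                 (trans (x∧[y∧⁇∶] y (¬ u) p q) (∧-congˡ (¬x∧⁇∶ u x v))))
        (cases (¬ y) (trans (¬x∧[y∧⁇∶] y u p q) (∧-congˡ (x∧⁇∶ u z w)))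
                     (trans (¬x∧[y∧⁇∶] y (¬ u) p q) (∧-congˡ (¬x∧⁇∶ u z w)))) ⟩
    r                                    ∎
    where
    p = u ⁇ x ∶ v
    q = u ⁇ z ∶ w
    r = y ⁇ p ∶ q

    cases : ∀ c {d s t s′ t′} → c ∧ (d ∧ s) ≈ c ∧ (d ∧ s′) → c ∧ (¬ d ∧ t) ≈ c ∧ (¬ d ∧ t′) →
            c ∧ (d ⁇ s ∶ t) ≈ c ∧ (d ⁇ s′ ∶ t′)
    cases c {d} {s} {t} {s′} {t′} e f = begin
      c ∧ (d ⁇ s ∶ t)                      ≈⟨ distribˡ-∧-∨ c (d ∧ s) (¬ d ∧ t) ⟩
      (c ∧ (d ∧ s)) ∨ (c ∧ (¬ d ∧ t))      ≈⟨ ∨-cong e f ⟩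
      (c ∧ (d ∧ s′)) ∨ (c ∧ (¬ d ∧ t′))    ≈⟨ distribˡ-∧-∨ c (d ∧ s′) (¬ d ∧ t′) ⟨
      c ∧ (d ⁇ s′ ∶ t′)                    ∎

  -- Translating derivations back to `CL₂`.

  -- The connectives are kept instead of being rewritten as conditionals, so that `unfold` undoes
  -- `embed` up to `≡`.
  unfold : CTerm A → SCLTerm A
  unfold (var n)     = var n
  unfold (atom b)    = atom b
  unfold 𝖳           = 𝖳
  unfold 𝖥           = 𝖥
  unfold (¬ s)       = ¬ unfold s
  unfold (s ∧ t)     = unfold s ∧ unfold t
  unfold (s ∨ t)     = unfold s ∨ unfold t
  unfold (s ◁ t ▷ u) = unfold t ⁇ unfold s ∶ unfold u

  unfold-embed : ∀ s → unfold (embed s) ≡ s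
  unfold-embed (var n)  = ≡.refl
  unfold-embed (atom b) = ≡.refl
  unfold-embed 𝖳        = ≡.refl
  unfold-embed 𝖥        = ≡.refl
  unfold-embed (¬ s)    = ≡.cong ¬_ (unfold-embed s)
  unfold-embed (s ∧ t)  = ≡.cong₂ _∧_ (unfold-embed s) (unfold-embed t)
  unfold-embed (s ∨ t)  = ≡.cong₂ _∨_ (unfold-embed s) (unfold-embed t)

  unfold-axiom : ∀ {s t} → CPcl+Def s t → unfold s ≈ unfold t
  unfold-axiom (cpcl (cpmem (cp (cp1 x y))))         = ⁇∶-𝖳 _ _
  unfold-axiom (cpcl (cpmem (cp (cp2 x y))))         = ⁇∶-𝖥 _ _
  unfold-axiom (cpcl (cpmem (cp (cp3 x))))           = ⁇∶-𝖳𝖥 _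
  unfold-axiom (cpcl (cpmem (cp (cp4 x y z u v))))   = ⁇∶-nested _ _ _ _ _
  unfold-axiom (cpcl (cpmem (mem x y z u v w)))      = ⁇∶-memorise _ _ _ _ _ _
  unfold-axiom (cpcl (cl x y z u v w))               = ⁇∶-exchange _ _ _ _ _ _
  unfold-axiom (¬-def x)                             = sym (⁇∶-𝖥𝖳 _)
  unfold-axiom (∧-def x y)                           = sym ([x∧y]∨[¬x∧𝖥]≈x∧y _ _)
  unfold-axiom 𝖥-def                                 = sym ¬𝖳≈𝖥
  unfold-axiom (∨-def x y)                           = trans (sym (¬-involutive _)) (¬-cong (deMorgan-∨ _ _))

  -- Stated for all of `CTerm A`, because `trans` may pass through terms outside the image of
  -- `embed`.
  unfold-sound : ∀ {s t} → CPcl+Def ⊢ᶜ s ≈ t → unfold s ≈ unfold t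
  unfold-sound (axiom e)        = unfold-axiom e
  unfold-sound refl             = refl
  unfold-sound (sym d)          = sym (unfold-sound d)
  unfold-sound (trans d e)      = trans (unfold-sound d) (unfold-sound e)
  unfold-sound (¬-cong d)       = ¬-cong (unfold-sound d)
  unfold-sound (∧-cong d e)     = ∧-cong (unfold-sound d) (unfold-sound e)
  unfold-sound (∨-cong d e)     = ∨-cong (unfold-sound d) (unfold-sound e)
  unfold-sound (◁▷-cong d e f)  = ⁇∶-cong (unfold-sound e) (unfold-sound d) (unfold-sound f)

  fromCℓSCL₂ : ∀ s t → CℓSCL₂⊢ s ≈ t → CL₂⊢ s ≈ t
  fromCℓSCL₂ s t d = ≡.subst₂ _≈_ (unfold-embed s) (unfold-embed t) (unfold-sound d)

-- Consequences of `CPcl` and the defining equations.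

module CPcl-Properties {a : Level} {A : Set a} where

  private
    infix 4 _≈_
    _≈_ : CTerm A → CTerm A → Set a
    _≈_ = CPcl+Def ⊢ᶜ_≈_

  setoid : Setoid a a
  setoid = record
    { Carrier       = CTerm A
    ; _≈_           = _≈_
    ; isEquivalence = record { refl = refl ; sym = sym ; trans = trans }
    }

  open SetoidReasoning setoid

  -- The superscripts mark the position that is rewritten: then, else or guard; the
  -- suffixes of memorise- and contract- trace the path to the repeated conditional.
  congᵗ : ∀ {x x′ y z} → x ≈ x′ → (x ◁ y ▷ z) ≈ (x′ ◁ y ▷ z)
  congᵗ p = ◁▷-cong p refl refl

  congᵉ : ∀ {x y z z′} → z ≈ z′ → (x ◁ y ▷ z) ≈ (x ◁ y ▷ z′)
  congᵉ p = ◁▷-cong refl refl p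

  congᵍ : ∀ {x y y′ z} → y ≈ y′ → (x ◁ y ▷ z) ≈ (x ◁ y′ ▷ z)
  congᵍ p = ◁▷-cong refl p refl

  ◁𝖳▷ : ∀ x y → (x ◁ 𝖳 ▷ y) ≈ x
  ◁𝖳▷ x y = axiom (cpcl (cpmem (cp (cp1 x y))))

  ◁𝖥▷ : ∀ x y → (x ◁ 𝖥 ▷ y) ≈ y
  ◁𝖥▷ x y = axiom (cpcl (cpmem (cp (cp2 x y))))

  𝖳◁▷𝖥 : ∀ x → (𝖳 ◁ x ▷ 𝖥) ≈ x
  𝖳◁▷𝖥 x = axiom (cpcl (cpmem (cp (cp3 x))))

  nested : ∀ x y z u v → (x ◁ (y ◁ z ▷ u) ▷ v) ≈ ((x ◁ y ▷ v) ◁ z ▷ (x ◁ u ▷ v))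
  nested x y z u v = axiom (cpcl (cpmem (cp (cp4 x y z u v))))

  memorise-ee : ∀ x y z u v w → (x ◁ y ▷ (z ◁ u ▷ (v ◁ y ▷ w))) ≈ (x ◁ y ▷ (z ◁ u ▷ w))
  memorise-ee x y z u v w = axiom (cpcl (cpmem (mem x y z u v w)))

  exchange : ∀ x y z u v w →
    ((x ◁ y ▷ z) ◁ u ▷ (v ◁ y ▷ w)) ≈ ((x ◁ u ▷ v) ◁ y ▷ (z ◁ u ▷ w))
  exchange x y z u v w = axiom (cpcl (cl x y z u v w))

  expand-¬ : ∀ x → ¬ x ≈ (𝖥 ◁ x ▷ 𝖳)
  expand-¬ x = axiom (¬-def x)

  expand-∧ : ∀ x y → x ∧ y ≈ (y ◁ x ▷ 𝖥)
  expand-∧ x y = axiom (∧-def x y)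

  -- Connectives in guard position.

  -- Also serves to carry laws about else branches over to then branches.
  ◁¬▷ : ∀ x y z → (x ◁ ¬ y ▷ z) ≈ (z ◁ y ▷ x)
  ◁¬▷ x y z = begin
    (x ◁ ¬ y ▷ z)                      ≈⟨ congᵍ (expand-¬ y) ⟩
    (x ◁ (𝖥 ◁ y ▷ 𝖳) ▷ z)              ≈⟨ nested x 𝖥 y 𝖳 z ⟩
    ((x ◁ 𝖥 ▷ z) ◁ y ▷ (x ◁ 𝖳 ▷ z))    ≈⟨ ◁▷-cong (◁𝖥▷ x z) refl (◁𝖳▷ x z) ⟩
    (z ◁ y ▷ x)                        ∎

  ◁∧▷ : ∀ x y z w → (x ◁ y ∧ z ▷ w) ≈ ((x ◁ z ▷ w) ◁ y ▷ w)
  ◁∧▷ x y z w = begin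
    (x ◁ y ∧ z ▷ w)                    ≈⟨ congᵍ (expand-∧ y z) ⟩
    (x ◁ (z ◁ y ▷ 𝖥) ▷ w)              ≈⟨ nested x z y 𝖥 w ⟩
    ((x ◁ z ▷ w) ◁ y ▷ (x ◁ 𝖥 ▷ w))    ≈⟨ congᵉ (◁𝖥▷ x w) ⟩
    ((x ◁ z ▷ w) ◁ y ▷ w)              ∎

  ◁∨▷ : ∀ x y z w → (x ◁ y ∨ z ▷ w) ≈ (x ◁ y ▷ (x ◁ z ▷ w))
  ◁∨▷ x y z w = begin
    (x ◁ y ∨ z ▷ w)                ≈⟨ congᵍ (axiom (∨-def y z)) ⟩
    (x ◁ ¬ (¬ y ∧ ¬ z) ▷ w)        ≈⟨ ◁¬▷ x (¬ y ∧ ¬ z) w ⟩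
    (w ◁ ¬ y ∧ ¬ z ▷ x)            ≈⟨ ◁∧▷ w (¬ y) (¬ z) x ⟩
    ((w ◁ ¬ z ▷ x) ◁ ¬ y ▷ x)      ≈⟨ ◁¬▷ (w ◁ ¬ z ▷ x) y x ⟩
    (x ◁ y ▷ (w ◁ ¬ z ▷ x))        ≈⟨ congᵉ (◁¬▷ w z x) ⟩
    (x ◁ y ▷ (x ◁ z ▷ w))          ∎

  -- By `𝖳◁▷𝖥` every term can be put in guard position, where `◁∨▷` applies.
  expand-∨ : ∀ x y → x ∨ y ≈ (𝖳 ◁ x ▷ y)
  expand-∨ x y = begin
    x ∨ y                      ≈⟨ 𝖳◁▷𝖥 (x ∨ y) ⟨
    (𝖳 ◁ x ∨ y ▷ 𝖥)            ≈⟨ ◁∨▷ 𝖳 x y 𝖥 ⟩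
    (𝖳 ◁ x ▷ (𝖳 ◁ y ▷ 𝖥))      ≈⟨ congᵉ (𝖳◁▷𝖥 y) ⟩
    (𝖳 ◁ x ▷ y)                ∎

  -- Variants of the memorising axiom.

  -- The axiom with the middle guard `u` negated.
  memorise-et : ∀ x y z u v w → (x ◁ y ▷ ((v ◁ y ▷ w) ◁ u ▷ z)) ≈ (x ◁ y ▷ (w ◁ u ▷ z))
  memorise-et x y z u v w = begin
    (x ◁ y ▷ ((v ◁ y ▷ w) ◁ u ▷ z))      ≈⟨ congᵉ (◁¬▷ z u (v ◁ y ▷ w)) ⟨
    (x ◁ y ▷ (z ◁ ¬ u ▷ (v ◁ y ▷ w)))    ≈⟨ memorise-ee x y z (¬ u) v w ⟩
    (x ◁ y ▷ (z ◁ ¬ u ▷ w))              ≈⟨ congᵉ (◁¬▷ z u w) ⟩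
    (x ◁ y ▷ (w ◁ u ▷ z))                ∎

  -- The axiom with the repeated guard `y` negated.
  memorise-te : ∀ x y z u v w → ((z ◁ u ▷ (v ◁ y ▷ w)) ◁ y ▷ x) ≈ ((z ◁ u ▷ v) ◁ y ▷ x)
  memorise-te x y z u v w = begin
    ((z ◁ u ▷ (v ◁ y ▷ w)) ◁ y ▷ x)        ≈⟨ congᵗ (congᵉ (◁¬▷ w y v)) ⟨
    ((z ◁ u ▷ (w ◁ ¬ y ▷ v)) ◁ y ▷ x)      ≈⟨ ◁¬▷ x y (z ◁ u ▷ (w ◁ ¬ y ▷ v)) ⟨
    (x ◁ ¬ y ▷ (z ◁ u ▷ (w ◁ ¬ y ▷ v)))    ≈⟨ memorise-ee x (¬ y) z u w v ⟩
    (x ◁ ¬ y ▷ (z ◁ u ▷ v))                ≈⟨ ◁¬▷ x y (z ◁ u ▷ v) ⟩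
    ((z ◁ u ▷ v) ◁ y ▷ x)                  ∎

  -- Choosing `𝖥` as the middle guard makes the middle conditional of `memorise-ee` vanish.
  contract-e : ∀ x y v w → (x ◁ y ▷ (v ◁ y ▷ w)) ≈ (x ◁ y ▷ w)
  contract-e x y v w = begin
    (x ◁ y ▷ (v ◁ y ▷ w))              ≈⟨ congᵉ (◁𝖥▷ 𝖳 (v ◁ y ▷ w)) ⟨
    (x ◁ y ▷ (𝖳 ◁ 𝖥 ▷ (v ◁ y ▷ w)))    ≈⟨ memorise-ee x y 𝖳 𝖥 v w ⟩
    (x ◁ y ▷ (𝖳 ◁ 𝖥 ▷ w))              ≈⟨ congᵉ (◁𝖥▷ 𝖳 w) ⟩
    (x ◁ y ▷ w)                        ∎

  -- The axioms of `CL₂` derived from conditionals.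

  ¬-involutive : ∀ x → ¬ ¬ x ≈ x
  ¬-involutive x = begin
    ¬ ¬ x              ≈⟨ expand-¬ (¬ x) ⟩
    (𝖥 ◁ ¬ x ▷ 𝖳)      ≈⟨ ◁¬▷ 𝖥 x 𝖳 ⟩
    (𝖳 ◁ x ▷ 𝖥)        ≈⟨ 𝖳◁▷𝖥 x ⟩
    x                  ∎

  deMorgan-∧ : ∀ x y → ¬ (x ∧ y) ≈ ¬ x ∨ ¬ y
  deMorgan-∧ x y = begin
    ¬ (x ∧ y)                  ≈⟨ expand-¬ (x ∧ y) ⟩
    (𝖥 ◁ x ∧ y ▷ 𝖳)            ≈⟨ ◁∧▷ 𝖥 x y 𝖳 ⟩
    ((𝖥 ◁ y ▷ 𝖳) ◁ x ▷ 𝖳)      ≈⟨ congᵗ (expand-¬ y) ⟨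
    (¬ y ◁ x ▷ 𝖳)              ≈⟨ ◁¬▷ 𝖳 x (¬ y) ⟨
    (𝖳 ◁ ¬ x ▷ ¬ y)            ≈⟨ expand-∨ (¬ x) (¬ y) ⟨
    ¬ x ∨ ¬ y                  ∎

  assoc-∧ : ∀ x y z → (x ∧ y) ∧ z ≈ x ∧ (y ∧ z)
  assoc-∧ x y z = begin
    (x ∧ y) ∧ z                ≈⟨ expand-∧ (x ∧ y) z ⟩
    (z ◁ x ∧ y ▷ 𝖥)            ≈⟨ ◁∧▷ z x y 𝖥 ⟩
    ((z ◁ y ▷ 𝖥) ◁ x ▷ 𝖥)      ≈⟨ congᵗ (expand-∧ y z) ⟨
    (y ∧ z ◁ x ▷ 𝖥)            ≈⟨ expand-∧ x (y ∧ z) ⟨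
    x ∧ (y ∧ z)                ∎

  distribˡ-∧-∨ : ∀ x y z → x ∧ (y ∨ z) ≈ (x ∧ y) ∨ (x ∧ z)
  distribˡ-∧-∨ x y z = begin
    x ∧ (y ∨ z)                                    ≈⟨ expand-∧ x (y ∨ z) ⟩
    (y ∨ z ◁ x ▷ 𝖥)                                ≈⟨ congᵗ (expand-∨ y z) ⟩
    -- The memory laws are used backwards to create two copies of `z ◁ x ▷ 𝖥`, because `◁∧▷` needs
    -- the same else branch twice.
    ((𝖳 ◁ y ▷ z) ◁ x ▷ 𝖥)                          ≈⟨ contract-e (𝖳 ◁ y ▷ z) x z 𝖥 ⟨
    ((𝖳 ◁ y ▷ z) ◁ x ▷ (z ◁ x ▷ 𝖥))                ≈⟨ memorise-te (z ◁ x ▷ 𝖥) x 𝖳 y z 𝖥 ⟨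
    ((𝖳 ◁ y ▷ (z ◁ x ▷ 𝖥)) ◁ x ▷ (z ◁ x ▷ 𝖥))      ≈⟨ ◁▷-cong (congᵉ (expand-∧ x z)) refl (expand-∧ x z) ⟨
    ((𝖳 ◁ y ▷ x ∧ z) ◁ x ▷ x ∧ z)                  ≈⟨ ◁∧▷ 𝖳 x y (x ∧ z) ⟨
    (𝖳 ◁ x ∧ y ▷ x ∧ z)                            ≈⟨ expand-∨ (x ∧ y) (x ∧ z) ⟨
    (x ∧ y) ∨ (x ∧ z)                              ∎

  distribʳ-∧-∨ : ∀ x y z → (x ∨ y) ∧ z ≈ (x ∧ z) ∨ (¬ x ∧ (y ∧ z))
  distribʳ-∧-∨ x y z = begin
    (x ∨ y) ∧ z                                ≈⟨ expand-∧ (x ∨ y) z ⟩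
    (z ◁ x ∨ y ▷ 𝖥)                            ≈⟨ ◁∨▷ z x y 𝖥 ⟩
    (z ◁ x ▷ (z ◁ y ▷ 𝖥))                      ≈⟨ congᵉ (expand-∧ y z) ⟨
    -- Writing `z` as `𝖳 ◁ z ▷ 𝖥` opens a second else branch; both else branches are then inflated
    -- to `𝖥 ◁ x ▷ y ∧ z`, which is `w`.
    (z ◁ x ▷ y ∧ z)                            ≈⟨ congᵗ (𝖳◁▷𝖥 z) ⟨
    ((𝖳 ◁ z ▷ 𝖥) ◁ x ▷ y ∧ z)                  ≈⟨ memorise-te (y ∧ z) x 𝖳 z 𝖥 (y ∧ z) ⟨
    ((𝖳 ◁ z ▷ (𝖥 ◁ x ▷ y ∧ z)) ◁ x ▷ y ∧ z)    ≈⟨ contract-e (𝖳 ◁ z ▷ (𝖥 ◁ x ▷ y ∧ z)) x 𝖥 (y ∧ z) ⟨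
    ((𝖳 ◁ z ▷ (𝖥 ◁ x ▷ y ∧ z)) ◁ x ▷ (𝖥 ◁ x ▷ y ∧ z))
                                               ≈⟨ ◁▷-cong (congᵉ w≈) refl w≈ ⟨
    ((𝖳 ◁ z ▷ w) ◁ x ▷ w)                      ≈⟨ ◁∧▷ 𝖳 x z w ⟨
    (𝖳 ◁ x ∧ z ▷ w)                            ≈⟨ expand-∨ (x ∧ z) w ⟨
    (x ∧ z) ∨ w                                ∎
    where
    w = ¬ x ∧ (y ∧ z)

    w≈ : w ≈ (𝖥 ◁ x ▷ y ∧ z)
    w≈ = trans (expand-∧ (¬ x) (y ∧ z)) (◁¬▷ (y ∧ z) x 𝖥)

  absorbs-∨-∧ : ∀ x y → x ∨ (x ∧ y) ≈ x
  absorbs-∨-∧ x y = begin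
    x ∨ (x ∧ y)              ≈⟨ expand-∨ x (x ∧ y) ⟩
    (𝖳 ◁ x ▷ x ∧ y)          ≈⟨ congᵉ (expand-∧ x y) ⟩
    (𝖳 ◁ x ▷ (y ◁ x ▷ 𝖥))    ≈⟨ contract-e 𝖳 x y 𝖥 ⟩
    (𝖳 ◁ x ▷ 𝖥)              ≈⟨ 𝖳◁▷𝖥 x ⟩
    x                        ∎

  -- After expansion the then branch is `y ∨ (y ∧ x)`, which absorption reduces to `y`.
  [x∧y]∨[y∧x] : ∀ x y → (x ∧ y) ∨ (y ∧ x) ≈ (y ◁ x ▷ (x ◁ y ▷ 𝖥))
  [x∧y]∨[y∧x] x y = begin
    (x ∧ y) ∨ (y ∧ x)                ≈⟨ expand-∨ (x ∧ y) (y ∧ x) ⟩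
    (𝖳 ◁ x ∧ y ▷ y ∧ x)              ≈⟨ ◁∧▷ 𝖳 x y (y ∧ x) ⟩
    ((𝖳 ◁ y ▷ y ∧ x) ◁ x ▷ y ∧ x)    ≈⟨ ◁▷-cong (sym (expand-∨ y (y ∧ x))) refl (expand-∧ y x) ⟩
    (y ∨ (y ∧ x) ◁ x ▷ (x ◁ y ▷ 𝖥))  ≈⟨ congᵗ (absorbs-∨-∧ y x) ⟩
    (y ◁ x ▷ (x ◁ y ▷ 𝖥))            ∎

  comm-∨-∧ : ∀ x y → (x ∧ y) ∨ (y ∧ x) ≈ (y ∧ x) ∨ (x ∧ y)
  comm-∨-∧ x y = begin
    (x ∧ y) ∨ (y ∧ x)                      ≈⟨ [x∧y]∨[y∧x] x y ⟩
    -- Writing the then branch as `𝖳 ◁ y ▷ 𝖥` puts `y` as guard in both branches, as `exchange`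
    -- requires; this is where the axiom `cl` enters.
    (y ◁ x ▷ (x ◁ y ▷ 𝖥))                  ≈⟨ congᵗ (𝖳◁▷𝖥 y) ⟨
    ((𝖳 ◁ y ▷ 𝖥) ◁ x ▷ (x ◁ y ▷ 𝖥))        ≈⟨ exchange 𝖳 y 𝖥 x x 𝖥 ⟩
    ((𝖳 ◁ x ▷ x) ◁ y ▷ (𝖥 ◁ x ▷ 𝖥))        ≈⟨ congᵗ 𝖳◁x▷x≈x ⟩
    -- In the else branch of `y` the value of `y` is known to be false, so the first `𝖥` may be
    -- replaced by `y`.
    (x ◁ y ▷ (𝖥 ◁ x ▷ 𝖥))                  ≈⟨ memorise-et x y 𝖥 x 𝖳 𝖥 ⟨
    (x ◁ y ▷ ((𝖳 ◁ y ▷ 𝖥) ◁ x ▷ 𝖥))        ≈⟨ congᵉ (congᵗ (𝖳◁▷𝖥 y)) ⟩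
    (x ◁ y ▷ (y ◁ x ▷ 𝖥))                  ≈⟨ [x∧y]∨[y∧x] y x ⟨
    (y ∧ x) ∨ (x ∧ y)                      ∎
    where
    𝖳◁x▷x≈x : (𝖳 ◁ x ▷ x) ≈ x
    𝖳◁x▷x≈x = begin
      (𝖳 ◁ x ▷ x)              ≈⟨ congᵉ (𝖳◁▷𝖥 x) ⟨
      (𝖳 ◁ x ▷ (𝖳 ◁ x ▷ 𝖥))    ≈⟨ contract-e 𝖳 x 𝖳 𝖥 ⟩
      (𝖳 ◁ x ▷ 𝖥)              ≈⟨ 𝖳◁▷𝖥 x ⟩
      x                        ∎

  -- Translating derivations of `CL₂`, and the equivalence.

  embed-axiom : ∀ {s t} → CL₂ s t → embed s ≈ embed t
  embed-axiom (¬¬-elim x)       = ¬-involutive _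
  embed-axiom (deMorgan x y)    = deMorgan-∧ _ _
  embed-axiom (∧-assoc x y z)   = assoc-∧ _ _ _
  embed-axiom (∧-distˡ-∨ x y z) = distribˡ-∧-∨ _ _ _
  embed-axiom (∧-distʳ-∨ x y z) = distribʳ-∧-∨ _ _ _
  embed-axiom (absorb x y)      = absorbs-∨-∧ _ _
  embed-axiom (∨-∧-comm x y)    = comm-∨-∧ _ _
  embed-axiom (𝖳-∧ x)           = trans (expand-∧ _ _) (◁𝖳▷ _ _)
  embed-axiom ¬𝖳                = sym (axiom 𝖥-def)

  toCℓSCL₂ : ∀ {s t} → CL₂⊢ s ≈ t → CℓSCL₂⊢ s ≈ t
  toCℓSCL₂ (axiom e)    = embed-axiom e
  toCℓSCL₂ refl         = refl
  toCℓSCL₂ (sym d)      = sym (toCℓSCL₂ d)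
  toCℓSCL₂ (trans d e)  = trans (toCℓSCL₂ d) (toCℓSCL₂ e)
  toCℓSCL₂ (¬-cong d)   = ¬-cong (toCℓSCL₂ d)
  toCℓSCL₂ (∧-cong d e) = ∧-cong (toCℓSCL₂ d) (toCℓSCL₂ e)
  toCℓSCL₂ (∨-cong d e) = ∨-cong (toCℓSCL₂ d) (toCℓSCL₂ e)

theorem3p13 : {a : Level} (A : Set a) (s t : SCLTerm A) → (CL₂⊢ s ≈ t) ⇔ (CℓSCL₂⊢ s ≈ t)
theorem3p13 A s t = mk⇔ CPcl-Properties.toCℓSCL₂ (CL₂-Properties.fromCℓSCL₂ s t)
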